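{- Let $x$ be a hypergame. Then: - $x\triangleright 0$ iff $x$ has a non-losing strategy for L; - $x\triangleleft 0$ iff $x$ has a non-losing strategy for R; - $x\bowtie 0$ iff $x$ has a non-losing strategy for II; - $x\,\|\,0$ iff $x$ has a non-losing strategy for I.
   Context: Hypergames: work in a universe of possibly non-wellfounded sets (set theory with the Antifoundation Axiom, and the Axiom of Choice). The class $\mathcal H$ of hypergames (also called games) is the carrier of the final coalgebra $(\mathcal H,\mathrm{id})$ of the functor $F(A)=\mathcal P(A)\times\mathcal P(A)$ on the category of classes and functional classes, where $\mathcal P$ is the powerset functor. Thus a hypergame is a pair $x=(X^L,X^R)$ of sets of hypergames; elements $x^L\in X^L$ and $x^R\in X^R$ are the Left and Right options of $x$. Positions of $x$ are the hypergames hereditarily reachable from $x$. $0=(\emptyset,\emptyset)$. Relations: let $\Phi$ be the (componentwise monotone) operator on pairs of binary relations on $\mathcal H$ given by $$\Phi(\mathcal R_1,\mathcal R_2)=\big(\{(x,y)\mid \forall x^R\in X^R.\ y\,\mathcal R_2\,x^R\ \wedge\ \forall y^L\in Y^L.\ y^L\,\mathcal R_2\,x\},\ \{(x,y)\mid \exists x^R\in X^R.\ y\,\mathcal R_1\,x^R\ \vee\ \exists y^L\in Y^L.\ y^L\,\mathcal R_1\,x\}\big).$$ The pair $(\trianglerighteq,\blacktriangleright)$ is the greatest fixpoint of $\Phi$ (note that $\blacktriangleright$ need not be the complement of $\trianglerighteq$). Define: $x\triangleright y$ iff $x\trianglerighteq y$ and $y\blacktriangleright x$; $x\triangleleft y$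 iff $y\triangleright x$; $x\bowtie y$ iff $x\trianglerighteq y$ and $y\trianglerighteq x$; $x\,\|\,y$ iff $x\blacktriangleright y$ and $y\blacktriangleright x$. Plays: L (Left) and R (Right) move alternately; either may start. Player I is the one who starts, player II the other one; LI means L acting as player I, and similarly LII, RI, RII. A play on $x$ is a (possibly empty) finite or infinite sequence $x_1^{K_1}x_2^{K_2}\cdots$ with $K_i\in\{L,R\}$ and $K_{i+1}\neq K_i$, such that, with $x_0=x$ and $x_i=(X_i^L,X_i^R)$, one has $x_{i+1}\in X_i^{K_{i+1}}$ for all $i\ge 0$. A finite play is winning for L (resp. R) if it ends with a position $y=(Y^L,Y^R)$ where R (resp. L) is next to move but $Y^R=\emptyset$ (resp. $Y^L=\emptyset$); the empty play ends at $x$ with the starting player next to move. Every infinite play is a draw. A play is non-losing for L (resp. R) if it is winning for L (resp. R) or is a draw. Strategies: for P in $\{$LI, LII, RI, RII$\}$ let $\mathrm{FPlay}^P_x$ be the set of finite plays on $x$ in which P has the prescribed role (first or second player) and is next to move (the empty play is included exactly when P is LI or RI). A strategy for P on $x$ is a partial function $f$ from $\mathrm{FPlay}^P_x$ to positions of $x$ such that $f(\pi)=x'$ implies that $\pi x'$ is a play, and $f(\pi)$ is defined whenever some $\pi x'$ is a play. The opponent of LI is RII, and of LII is RI (and conversely). A play $\pi$ is coherent with $f$ if for each proper prefix $\pi'$ of $\pi$ where P is next to move, $f(\pi')=x'$ implies $\pi'x'$ is a prefix of $\pi$. For a strategy $f$ for P and a strategy $f'$ for the opponent, $f*f'$ is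 the unique maximal play coherent with both. $f$ is non-losing for P if $f*f'$ is non-losing for P (i.e. for L or R accordingly) for every strategy $f'$ of the opponent. A strategy for L is a pair of strategies for LI and LII; for R, for RI and RII; for I, for LI and RI; for II, for LII and RII. Such a pair is non-losing if both components are. -}

module Defs where

open import Level using (Level; Setω; _⊔_) renaming (suc to lsuc)
open import Data.Empty.Polymorphic using (⊥)
open import Data.List.Base using (List; []; _∷_; _∷ʳ_; length; applyUpTo)
open import Data.List.Relation.Binary.Pointwise using (Pointwise)
open import Data.List.Relation.Binary.Prefix.Heterogeneous using (Prefix)
open import Data.Maybe.Base using (Maybe; just)
import Data.Maybe.Relation.Binary.Pointwise as Maybe
open import Data.Nat.Base using (ℕ)
open import Data.Product.Base using (Σ-syntax; ∃-syntax; _×_; _,_; proj₁; proj₂)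
open import Data.Sum.Base using (_⊎_; inj₁; inj₂)
open import Data.Unit.Polymorphic using (⊤; tt)
open import Relation.Binary.Bundles using (Setoid)
open import Relation.Binary.Core using (Rel; _⇒_)
open import Relation.Binary.PropositionalEquality.Core using (_≡_)
open import Relation.Nullary.Negation.Core using (¬_)

private
  variable
    ℓ r r′ : Level

-- The set-theoretic axiom of choice, in the form "every equivalence relation
-- has a system of representatives".  It does not follow from the choice
-- principle validated by Σ-types, because the chosen representative depends
-- only on the equivalence class.

record Representatives {a r} (S : Setoid a r) : Set (a ⊔ r) where
  open Setoid S
  field
    rep      : Carrier → Carrier
    rep-≈    : ∀ x → rep x ≈ x
    rep-cong : ∀ {x y} → x ≈ y → rep x ≡ rep y

AxiomOfChoice : Setω
AxiomOfChoice = ∀ {a r} (S : Setoid a r) → Representatives S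

data Side : Set where
  L R : Side

opp : Side → Side
opp L = R
opp R = L

-- The final coalgebra of A ↦ 𝒫 A × 𝒫 A is presented as in Aczel's model of
-- antifoundation: a hypergame is pictured by a pointed graph with Left and
-- Right edges, arbitrary cycles and infinite paths being allowed, and two
-- graphs picture the same hypergame iff they are bisimilar.  So Hypergame is a
-- class (it lives one universe above the sets), the equality of hypergames is
-- _≈_, and the options of a hypergame form a set.

record Hypergame ℓ : Set (lsuc ℓ) where
  field
    Node : Set ℓ
    Edge : Side → Node → Node → Set ℓ
    root : Node

open Hypergame

_at_ : (x : Hypergame ℓ) → Node x → Hypergame ℓ
x at n = record { Node = Node x ; Edge = Edge x ; root = n }

record IsBisimulation (x y : Hypergame ℓ) (B : Node x → Node y → Set ℓ) : Set ℓ where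
  field
    forth : ∀ {m n} → B m n → ∀ K {m′} → Edge x K m m′ → ∃[ n′ ] Edge y K n n′ × B m′ n′
    back  : ∀ {m n} → B m n → ∀ K {n′} → Edge y K n n′ → ∃[ m′ ] Edge x K m m′ × B m′ n′

infix 4 _≈_ _∈[_]_

_≈_ : Rel (Hypergame ℓ) (lsuc ℓ)
x ≈ y = ∃[ B ] IsBisimulation x y B × B (root x) (root y)

-- x′ ∈[ L ] x and x′ ∈[ R ] x mean x′ ∈ Xᴸ and x′ ∈ Xᴿ, where x = (Xᴸ , Xᴿ).
_∈[_]_ : Hypergame ℓ → Side → Hypergame ℓ → Set (lsuc ℓ)
x′ ∈[ K ] x = ∃[ n ] Edge x K (root x) n × x at n ≈ x′

𝟘 : Hypergame ℓ
𝟘 = record { Node = ⊤ ; Edge = λ _ _ _ → ⊥ ; root = tt }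

RelPair : ∀ ℓ r → Set (lsuc ℓ ⊔ lsuc r)
RelPair ℓ r = Rel (Hypergame ℓ) r × Rel (Hypergame ℓ) r

infix 4 _⊆₂_

_⊆₂_ : RelPair ℓ r → RelPair ℓ r′ → Set _
(P₁ , P₂) ⊆₂ (Q₁ , Q₂) = (P₁ ⇒ Q₁) × (P₂ ⇒ Q₂)

Φ : RelPair ℓ r → RelPair ℓ (lsuc ℓ ⊔ r)
Φ (P₁ , P₂) =
    (λ x y → (∀ {xᴿ} → xᴿ ∈[ R ] x → P₂ y xᴿ) × (∀ {yᴸ} → yᴸ ∈[ L ] y → P₂ yᴸ x))
  , (λ x y → (∃[ xᴿ ] xᴿ ∈[ R ] x × P₁ y xᴿ) ⊎ (∃[ yᴸ ] yᴸ ∈[ L ] y × P₁ yᴸ x))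

-- The greatest fixpoint of Φ, as the union of all pairs P ⊆₂ Φ P.  The pairs P
-- need not be assumed to respect _≈_: the closure of such a pair under _≈_ is
-- again such a pair, so the union is the same.
infix 4 _⊵_ _▶_ _▷_ _◁_ _⋈_ _∥_

_⊵_ _▶_ : Rel (Hypergame ℓ) (lsuc (lsuc ℓ))
_⊵_ {ℓ} x y = Σ[ P ∈ RelPair ℓ (lsuc ℓ) ] P ⊆₂ Φ P × proj₁ P x y
_▶_ {ℓ} x y = Σ[ P ∈ RelPair ℓ (lsuc ℓ) ] P ⊆₂ Φ P × proj₂ P x y

⊵▶-postfixed : _⊆₂_ {ℓ} (_⊵_ , _▶_) (Φ (_⊵_ , _▶_))
⊵▶-postfixed =
    (λ { (P , post , p) → (λ o → P , post , proj₁ (proj₁ post p) o)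
                        , (λ o → P , post , proj₂ (proj₁ post p) o) })
  , (λ { (P , post , p) → lift P post (proj₂ post p) })
  where
  lift : ∀ (P : RelPair ℓ (lsuc ℓ)) → P ⊆₂ Φ P → ∀ {x y} →
         proj₂ (Φ P) x y → proj₂ (Φ (_⊵_ , _▶_)) x y
  lift P post (inj₁ (z , o , p)) = inj₁ (z , o , P , post , p)
  lift P post (inj₂ (z , o , p)) = inj₂ (z , o , P , post , p)

_▷_ _◁_ _⋈_ _∥_ : Rel (Hypergame ℓ) (lsuc (lsuc ℓ))
x ▷ y = x ⊵ y × y ▶ x
x ◁ y = y ▷ x
x ⋈ y = x ⊵ y × y ⊵ x
x ∥ y = x ▶ y × y ▶ x

-- A play x₁ x₂ … is recorded without the labels Kᵢ: they alternate, hence are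
-- determined by the side that starts, which is a parameter of the notions below.

data Play ℓ : Set (lsuc ℓ) where
  fin : List (Hypergame ℓ) → Play ℓ
  inf : (ℕ → Hypergame ℓ) → Play ℓ

data IsFinitePlay {ℓ} : Side → Hypergame ℓ → List (Hypergame ℓ) → Set (lsuc ℓ) where
  []  : ∀ {s x} → IsFinitePlay s x []
  _∷_ : ∀ {s x x′ π} → x′ ∈[ s ] x → IsFinitePlay (opp s) x′ π → IsFinitePlay s x (x′ ∷ π)

IsPlay : Side → Hypergame ℓ → Play ℓ → Set (lsuc ℓ)
IsPlay s x (fin π) = IsFinitePlay s x π
IsPlay s x (inf g) = ∀ n → IsFinitePlay s x (applyUpTo g n)

next : Side → List (Hypergame ℓ) → Side
next s []      = s
next s (_ ∷ π) = next (opp s) π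

final : Hypergame ℓ → List (Hypergame ℓ) → Hypergame ℓ
final x []       = x
final x (x′ ∷ π) = final x′ π

infix 4 _⊑_ _⊏_

_⊑_ : Rel (Play ℓ) (lsuc ℓ)
fin π ⊑ fin ρ = Prefix _≈_ π ρ
fin π ⊑ inf g = Pointwise _≈_ π (applyUpTo g (length π))
inf _ ⊑ fin _ = ⊥
inf g ⊑ inf h = ∀ n → g n ≈ h n

_⊏_ : Rel (Play ℓ) (lsuc ℓ)
π ⊏ ρ = π ⊑ ρ × ¬ (ρ ⊑ π)

module _ (s : Side) (x : Hypergame ℓ) (K : Side) where

  Winning : Play ℓ → Set (lsuc ℓ)
  Winning (fin π) = next s π ≡ opp K × (∀ y → ¬ (y ∈[ opp K ] final x π))
  Winning (inf _) = ⊥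

  Draw : Play ℓ → Set (lsuc ℓ)
  Draw (fin _) = ⊥
  Draw (inf _) = ⊤

  NonLosingPlay : Play ℓ → Set (lsuc ℓ)
  NonLosingPlay π = Winning π ⊎ Draw π

-- A side together with a role, the role being encoded by the side that starts.
record Agent : Set where
  constructor agent
  field
    side    : Side
    starter : Side

open Agent

LI LII RI RII : Agent
LI  = agent L L
LII = agent L R
RI  = agent R R
RII = agent R L

opponent : Agent → Agent
opponent (agent K s) = agent (opp K) s

record FPlay (A : Agent) (x : Hypergame ℓ) : Set (lsuc ℓ) where
  field
    moves  : List (Hypergame ℓ)
    isPlay : IsFinitePlay (starter A) x moves
    turn   : next (starter A) moves ≡ side A

open FPlay

-- Partial functions are functions into Maybe.  By legal, the values of choose
-- are positions of x.
record Strategy (A : Agent) (x : Hypergame ℓ) : Set (lsuc ℓ) where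
  field
    choose      : FPlay A x → Maybe (Hypergame ℓ)
    choose-cong : ∀ {π ρ} → Pointwise _≈_ (moves π) (moves ρ) →
                  Maybe.Pointwise _≈_ (choose π) (choose ρ)
    legal       : ∀ π {x′} → choose π ≡ just x′ →
                  IsFinitePlay (starter A) x (moves π ∷ʳ x′)
    total       : ∀ π {x′} → IsFinitePlay (starter A) x (moves π ∷ʳ x′) →
                  ∃[ z ] choose π ≡ just z

open Strategy

Coherent : ∀ {A} {x : Hypergame ℓ} → Strategy A x → Play ℓ → Set (lsuc ℓ)
Coherent {A = A} {x} f π =
  ∀ (π′ : FPlay A x) → fin (moves π′) ⊏ π →
  ∀ {x′} → choose f π′ ≡ just x′ → fin (moves π′ ∷ʳ x′) ⊑ π

-- π is the play f * f′.
record IsProduct {A} {x : Hypergame ℓ} (f : Strategy A x) (f′ : Strategy (opponent A) x)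
                 (π : Play ℓ) : Set (lsuc ℓ) where
  field
    isPlay    : IsPlay (starter A) x π
    coherent  : Coherent f π
    coherent′ : Coherent f′ π
    maximal   : ∀ ρ → IsPlay (starter A) x ρ → Coherent f ρ → Coherent f′ ρ →
                π ⊑ ρ → ρ ⊑ π

NonLosing : ∀ {A} {x : Hypergame ℓ} → Strategy A x → Set (lsuc ℓ)
NonLosing {A = A} {x} f =
  ∀ (f′ : Strategy (opponent A) x) →
  ∃[ π ] IsProduct f f′ π × NonLosingPlay (starter A) x (side A) π

data Player : Set where
  Left Right I II : Player

components : Player → Agent × Agent
components Left  = LI , LII
components Right = RI , RII
components I     = LI , RI
components II    = LII , RII

StrategyFor : Player → Hypergame ℓ → Set (lsuc ℓ)
StrategyFor p x = Strategy (proj₁ (components p)) x × Strategy (proj₂ (components p)) x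

NonLosingFor : ∀ p {x : Hypergame ℓ} → StrategyFor p x → Set (lsuc ℓ)
NonLosingFor p (f , g) = NonLosing f × NonLosing g

HasNonLosingStrategyFor : Player → Hypergame ℓ → Set (lsuc ℓ)
HasNonLosingStrategyFor p x = Σ[ f ∈ StrategyFor p x ] NonLosingFor p f

{-# OPTIONS --safe #-}

-- A player K survives from a position exactly when the position belongs to an
-- invariant under which K, when to move, can stay inside, and which every move
-- of the opponent preserves; the pair (⊵ , ▶) against 𝟘 is the largest such
-- invariant.  Moving inside an invariant is a non-losing strategy, because a
-- finite maximal play cannot stop at K's turn.  Conversely the positions
-- reached by plays coherent with a non-losing strategy form an invariant: were
-- K stuck after such a play, an opponent following that play would beat K.

module Submission where

open import Defs
open import Axiom.ExcludedMiddle using (ExcludedMiddle)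
open import Data.Empty using (⊥-elim)
open import Data.List.Base using (List; []; _∷_; _∷ʳ_; length; applyUpTo)
open import Data.List.Properties using (applyUpTo-∷ʳ)
open import Data.List.Relation.Binary.Pointwise as Pointwise using (Pointwise; []; _∷_)
open import Data.List.Relation.Binary.Prefix.Heterogeneous using (Prefix; []; _∷_)
import Data.List.Relation.Binary.Prefix.Heterogeneous.Properties as Prefix
open import Data.List.Reverse using (Reverse; reverseView; []; _∶_∶ʳ_)
open import Data.Maybe.Base using (Maybe; just; nothing)
import Data.Maybe.Relation.Binary.Pointwise as Maybe
open import Data.Nat.Base using (ℕ; zero; suc)
open import Data.Product.Base using (Σ-syntax; ∃-syntax; _×_; _,_; proj₁; proj₂; swap)
open import Data.Sum.Base using (_⊎_; inj₁; inj₂)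
open import Data.Unit.Polymorphic using (tt)
open import Function.Base using (_∘_)
open import Function.Bundles using (_⇔_; mk⇔; Equivalence)
open import Level using (Level; _⊔_) renaming (suc to lsuc)
open import Relation.Binary.Bundles using (Setoid)
open import Relation.Binary.PropositionalEquality.Core
  using (_≡_; _≢_; refl; sym; trans; cong; subst; subst₂)
open import Relation.Nullary.Decidable.Core using (yes; no; decidable-stable)
open import Relation.Nullary.Negation.Core using (¬_; contradiction)

open Hypergame
open IsBisimulation
open Agent
open FPlay
open Strategy
open IsProduct

private
  variable
    ℓ r : Level
    x y z w : Hypergame ℓ
    π ρ σ : List (Hypergame ℓ)
    s t K : Side
    A : Agent

-- Bisimilarity as equality of hypergames.

≈-refl : x ≈ x
≈-refl = _≡_
       , record { forth = λ { refl K e → _ , e , refl } ; back = λ { refl K e → _ , e , refl } }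
       , refl

≈-sym : x ≈ y → y ≈ x
≈-sym (B , bis , b) = (λ n m → B m n) , record { forth = back bis ; back = forth bis } , b

≈-trans : x ≈ y → y ≈ z → x ≈ z
≈-trans {x = x} {y = y} {z = z} (B , β , b) (C , γ , c) =
  (λ m k → ∃[ n ] B m n × C n k) , record { forth = fo ; back = ba } , _ , b , c
  where
  fo : ∀ {m k} → ∃[ n ] B m n × C n k → ∀ K {m′} → Edge x K m m′ →
       ∃[ k′ ] Edge z K k k′ × ∃[ n′ ] B m′ n′ × C n′ k′
  fo (n , b , c) K e with forth β b K e
  ... | n′ , e′ , b′ with forth γ c K e′
  ... | k′ , e″ , c′ = k′ , e″ , n′ , b′ , c′
  ba : ∀ {m k} → ∃[ n ] B m n × C n k → ∀ K {k′} → Edge z K k k′ →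
       ∃[ m′ ] Edge x K m m′ × ∃[ n′ ] B m′ n′ × C n′ k′
  ba (n , b , c) K e with back γ c K e
  ... | n′ , e′ , c′ with back β b K e′
  ... | m′ , e″ , b′ = m′ , e″ , n′ , b′ , c′

hypergameSetoid : ∀ ℓ → Setoid (lsuc ℓ) (lsuc ℓ)
hypergameSetoid ℓ = record
  { Carrier       = Hypergame ℓ
  ; _≈_           = _≈_
  ; isEquivalence = record { refl = ≈-refl ; sym = ≈-sym ; trans = ≈-trans }
  }

movesSetoid : ∀ ℓ → Setoid (lsuc ℓ) (lsuc ℓ)
movesSetoid ℓ = Pointwise.setoid (hypergameSetoid ℓ)

∈-respˡ : z ≈ w → z ∈[ K ] x → w ∈[ K ] x
∈-respˡ z≈w (n , e , n≈z) = n , e , ≈-trans n≈z z≈w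

∈-respʳ : x ≈ y → z ∈[ K ] x → z ∈[ K ] y
∈-respʳ {K = K} (B , β , b) (n , e , n≈z) with forth β b K e
... | n′ , e′ , b′ =
  -- The conditions on a bisimulation do not mention roots, so the same `B` relates the two graphs
  -- re-rooted at the option nodes; only the record has to be rebuilt.
  n′ , e′ , ≈-trans (≈-sym (B , record { forth = forth β ; back = back β } , b′)) n≈z

-- Sides to move and finite plays.

opp-≢ : K ≢ opp K
opp-≢ {L} ()
opp-≢ {R} ()

opp-involutive : ∀ K → opp (opp K) ≡ K
opp-involutive L = refl
opp-involutive R = refl

≡⊎≡opp : ∀ t K → t ≡ K ⊎ t ≡ opp K
≡⊎≡opp L L = inj₁ refl
≡⊎≡opp L R = inj₂ refl
≡⊎≡opp R L = inj₂ refl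
≡⊎≡opp R R = inj₁ refl

next-cong : Pointwise _≈_ π ρ → next s π ≡ next s ρ
next-cong []       = refl
next-cong (_ ∷ ps) = next-cong ps

next-∷ʳ : ∀ s (π : List (Hypergame ℓ)) {z} → next s (π ∷ʳ z) ≡ opp (next s π)
next-∷ʳ s []      = refl
next-∷ʳ s (_ ∷ π) = next-∷ʳ (opp s) π

final-∷ʳ : ∀ (x : Hypergame ℓ) π {z} → final x (π ∷ʳ z) ≡ z
final-∷ʳ x []      = refl
final-∷ʳ x (y ∷ π) = final-∷ʳ y π

finitePlay-prefix : x ≈ y → Prefix _≈_ π ρ → IsFinitePlay s y ρ → IsFinitePlay s x π
finitePlay-prefix e []       _       = []
finitePlay-prefix e (p ∷ ps) (o ∷ q) =
  ∈-respʳ (≈-sym e) (∈-respˡ (≈-sym p) o) ∷ finitePlay-prefix p ps q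

finitePlay-cong : Pointwise _≈_ π ρ → IsFinitePlay s x ρ → IsFinitePlay s x π
finitePlay-cong = finitePlay-prefix ≈-refl ∘ Prefix.fromPointwise

finitePlay-∷ʳ : IsFinitePlay s x π → z ∈[ next s π ] final x π → IsFinitePlay s x (π ∷ʳ z)
finitePlay-∷ʳ []      o = o ∷ []
finitePlay-∷ʳ (p ∷ q) o = p ∷ finitePlay-∷ʳ q o

finitePlay-last : ∀ π → IsFinitePlay s x (π ∷ʳ z) → z ∈[ next s π ] final x π
finitePlay-last []      (o ∷ _) = o
finitePlay-last (_ ∷ π) (_ ∷ q) = finitePlay-last π q

-- The prefix order on plays.

prefix-refl : Prefix _≈_ π π
prefix-refl = Prefix.fromPointwise (Pointwise.refl ≈-refl)

prefix-trans : Prefix _≈_ π ρ → Prefix _≈_ ρ σ → Prefix _≈_ π σ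
prefix-trans = Prefix.trans ≈-trans

∷ʳ-cong : Pointwise _≈_ π ρ → z ≈ w → Pointwise _≈_ (π ∷ʳ z) (ρ ∷ʳ w)
∷ʳ-cong ps e = Pointwise.++⁺ ps (e ∷ [])

prefix-∷ʳ : ∀ (π : List (Hypergame ℓ)) {z} → Prefix _≈_ π (π ∷ʳ z)
prefix-∷ʳ []      = []
prefix-∷ʳ (_ ∷ π) = ≈-refl ∷ prefix-∷ʳ π

prefix-∷ʳ⁻ : ∀ (σ π : List (Hypergame ℓ)) {w z} → Prefix _≈_ (σ ∷ʳ w) (π ∷ʳ z) →
             Prefix _≈_ (σ ∷ʳ w) π ⊎ (Pointwise _≈_ σ π × w ≈ z)
prefix-∷ʳ⁻ []          []      (e ∷ _) = inj₂ ([] , e)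
prefix-∷ʳ⁻ []          (_ ∷ _) (e ∷ _) = inj₁ (e ∷ [])
prefix-∷ʳ⁻ (_ ∷ [])    []      (_ ∷ ())
prefix-∷ʳ⁻ (_ ∷ _ ∷ _) []      (_ ∷ ())
prefix-∷ʳ⁻ (_ ∷ σ)     (_ ∷ π) (e ∷ p) with prefix-∷ʳ⁻ σ π p
... | inj₁ q        = inj₁ (e ∷ q)
... | inj₂ (q , e′) = inj₂ (e ∷ q , e′)

⊑-transˡ : ∀ p → Prefix _≈_ σ π → fin π ⊑ p → fin σ ⊑ p
⊑-transˡ (fin _) q        p       = prefix-trans q p
⊑-transˡ (inf g) []       p       = []
⊑-transˡ (inf g) (e ∷ q)  (d ∷ p) = ≈-trans e d ∷ ⊑-transˡ (inf (g ∘ suc)) q p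

∷ʳ⊑-unique : ∀ (π : List (Hypergame ℓ)) p {w z} → fin (π ∷ʳ w) ⊑ p → fin (π ∷ʳ z) ⊑ p → w ≈ z
∷ʳ⊑-unique []      (fin _)       (d ∷ _) (e ∷ _) = ≈-trans d (≈-sym e)
∷ʳ⊑-unique []      (inf g)       (d ∷ _) (e ∷ _) = ≈-trans d (≈-sym e)
∷ʳ⊑-unique (_ ∷ π) (fin (_ ∷ ρ)) (_ ∷ p) (_ ∷ q) = ∷ʳ⊑-unique π (fin ρ) p q
∷ʳ⊑-unique (_ ∷ π) (inf g)       (_ ∷ p) (_ ∷ q) = ∷ʳ⊑-unique π (inf (g ∘ suc)) p q

⊏⇒∷ʳ⊑ : ∀ (π : List (Hypergame ℓ)) p → fin π ⊏ p → ∃[ w ] fin (π ∷ʳ w) ⊑ p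
⊏⇒∷ʳ⊑ []      (fin [])      (_ , ¬p)    = contradiction [] ¬p
⊏⇒∷ʳ⊑ []      (fin (w ∷ ρ)) _           = w , ≈-refl ∷ []
⊏⇒∷ʳ⊑ (_ ∷ π) (fin (_ ∷ ρ)) (e ∷ p , ¬p) with ⊏⇒∷ʳ⊑ π (fin ρ) (p , ¬p ∘ (≈-sym e ∷_))
... | w , q = w , e ∷ q
⊏⇒∷ʳ⊑ []      (inf g)       _           = g 0 , ≈-refl ∷ []
⊏⇒∷ʳ⊑ (_ ∷ π) (inf g)       (e ∷ p , _) with ⊏⇒∷ʳ⊑ π (inf (g ∘ suc)) (p , λ ())
... | w , q = w , e ∷ q

∷ʳ⋢ : ∀ (π : List (Hypergame ℓ)) p {w} → fin (π ∷ʳ w) ⊑ p → ¬ (p ⊑ fin π)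
∷ʳ⋢ []      (fin (_ ∷ _)) p       ()
∷ʳ⋢ (_ ∷ π) (fin (_ ∷ ρ)) (_ ∷ p) (_ ∷ q) = ∷ʳ⋢ π (fin ρ) p q
∷ʳ⋢ π       (inf g)       p       ()

∷ʳ⊑⇒⊏ : ∀ (π : List (Hypergame ℓ)) p {w} → fin (π ∷ʳ w) ⊑ p → fin π ⊏ p
∷ʳ⊑⇒⊏ π p q = ⊑-transˡ p (prefix-∷ʳ π) q , ∷ʳ⋢ π p q

play-finite : ∀ π p → IsPlay s x p → fin π ⊑ p → IsFinitePlay s x π
play-finite π (fin ρ) q π⊑ρ = finitePlay-prefix ≈-refl π⊑ρ q
play-finite π (inf g) q π⊑g = finitePlay-cong π⊑g (q (length π))

-- Plays that follow a strategy.

choose-unique : ∀ (f : Strategy A x) (p q : FPlay A x) {z w} → Pointwise _≈_ (moves p) (moves q) →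
                choose f p ≡ just z → choose f q ≡ just w → z ≈ w
choose-unique f p q ps cz cw = Maybe.drop-just (subst₂ (Maybe.Pointwise _≈_) cz cw (choose-cong f ps))

-- Coherence restated without proper prefixes, as a condition on the moves that `p` actually makes
-- at the agent's turns. In this form it passes to prefixes at once and can be checked one appended
-- move at a time.
Follows : {x : Hypergame ℓ} → Strategy A x → Play ℓ → Set (lsuc ℓ)
Follows {A = A} {x = x} f p =
  ∀ (π : FPlay A x) {w z} → fin (moves π ∷ʳ w) ⊑ p → choose f π ≡ just z → z ≈ w

coherent⇒follows : ∀ (f : Strategy A x) p → Coherent f p → Follows f p
coherent⇒follows f p coh π w⊑p cz =
  ∷ʳ⊑-unique (moves π) p (coh π (∷ʳ⊑⇒⊏ (moves π) p w⊑p) cz) w⊑p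

follows⇒coherent : ∀ (f : Strategy A x) p → Follows f p → Coherent f p
follows⇒coherent f p fol π π⊏p cz with ⊏⇒∷ʳ⊑ (moves π) p π⊏p
... | w , w⊑p = ⊑-transˡ p
  (Prefix.fromPointwise (∷ʳ-cong (Pointwise.refl ≈-refl) (fol π w⊑p cz))) w⊑p

follows-[] : ∀ (f : Strategy A x) → Follows f (fin [])
follows-[] f π w⊑[] _ = contradiction [] (∷ʳ⋢ (moves π) (fin []) w⊑[])

follows-prefix : ∀ (f : Strategy A x) → Prefix _≈_ σ π → Follows f (fin π) → Follows f (fin σ)
follows-prefix f σ⊑π fol p w⊑σ = fol p (prefix-trans w⊑σ σ⊑π)

follows-∷ʳ : ∀ (f : Strategy A x) → Follows f (fin π) →
             (∀ p {w} → Pointwise _≈_ (moves p) π → choose f p ≡ just w → w ≈ z) →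
             Follows f (fin (π ∷ʳ z))
follows-∷ʳ {π = π} f fol hz p w⊑ cw with prefix-∷ʳ⁻ (moves p) π w⊑
... | inj₁ q        = fol p q cw
... | inj₂ (q , e)  = ≈-trans (hz p q cw) (≈-sym e)

follows-∷ʳ-chosen : ∀ (f : Strategy A x) (p : FPlay A x) → Follows f (fin (moves p)) →
                    choose f p ≡ just z → Follows f (fin (moves p ∷ʳ z))
follows-∷ʳ-chosen f p fol cz = follows-∷ʳ f fol (λ q e cw → choose-unique f q p e cw cz)

follows-∷ʳ-idle : ∀ (f : Strategy A x) → Follows f (fin π) → next (starter A) π ≢ side A →
                  Follows f (fin (π ∷ʳ z))
follows-∷ʳ-idle f fol idle =
  follows-∷ʳ f fol (λ q e _ → contradiction (trans (sym (next-cong e)) (turn q)) idle)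

-- A departure from `f` already shows in a finite initial segment.
follows-inf : ∀ (f : Strategy A x) g → (∀ n → Follows f (fin (applyUpTo g n))) → Follows f (inf g)
follows-inf f g fol p w⊑g = fol _ p (Prefix.fromPointwise w⊑g)

-- The product of two opposing strategies.

module Joint {K s : Side} {x : Hypergame ℓ}
             (f : Strategy (agent K s) x) (f′ : Strategy (agent (opp K) s) x) where

  record JointPlay (π : List (Hypergame ℓ)) : Set (lsuc ℓ) where
    field
      play     : IsFinitePlay s x π
      follows  : Follows f (fin π)
      follows′ : Follows f′ (fin π)

  open JointPlay

  joint-[] : JointPlay []
  joint-[] = record { play = [] ; follows = follows-[] f ; follows′ = follows-[] f′ }

  -- The move `y` only witnesses that the game is not over. Totality then makes the strategy of the
  -- side to move supply `z`, while the other strategy is idle.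
  joint-∷ʳ : JointPlay π → IsFinitePlay s x (π ∷ʳ y) → ∃[ z ] JointPlay (π ∷ʳ z)
  joint-∷ʳ {π} j q with ≡⊎≡opp (next s π) K
  ... | inj₁ t with total f (record { moves = π ; isPlay = play j ; turn = t }) q
  ...   | z , cz = z , record
    { play     = legal f _ cz
    ; follows  = follows-∷ʳ-chosen f _ (follows j) cz
    ; follows′ = follows-∷ʳ-idle f′ (follows′ j) (opp-≢ ∘ trans (sym t))
    }
  joint-∷ʳ {π} j q | inj₂ t with total f′ (record { moves = π ; isPlay = play j ; turn = t }) q
  ...   | z , cz = z , record
    { play     = legal f′ _ cz
    ; follows  = follows-∷ʳ-idle f (follows j) (λ t′ → opp-≢ (trans (sym t′) t))
    ; follows′ = follows-∷ʳ-chosen f′ _ (follows′ j) cz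
    }

  -- As `z` is legal, the strategy of the side to move is defined after `π`, and both `z` and `w`
  -- agree with its value.
  follows-both-unique : ∀ p → Follows f p → Follows f′ p → ∀ π {w z} → IsFinitePlay s x (π ∷ʳ z) →
                          Follows f (fin (π ∷ʳ z)) → Follows f′ (fin (π ∷ʳ z)) →
                          fin (π ∷ʳ w) ⊑ p → z ≈ w
  follows-both-unique p fol fol′ π q folz folz′ w⊑p with ≡⊎≡opp (next s π) K
  follows-both-unique p fol fol′ π q folz folz′ w⊑p | inj₁ t
    with total f (record { moves = π ; isPlay = finitePlay-prefix ≈-refl (prefix-∷ʳ π) q ; turn = t }) q
  ...   | _ , c = ≈-trans (≈-sym (folz _ prefix-refl c)) (fol _ w⊑p c)
  follows-both-unique p fol fol′ π q folz folz′ w⊑p | inj₂ t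
    with total f′ (record { moves = π ; isPlay = finitePlay-prefix ≈-refl (prefix-∷ʳ π) q ; turn = t }) q
  ...   | _ , c = ≈-trans (≈-sym (folz′ _ prefix-refl c)) (fol′ _ w⊑p c)

  infiniteProduct : (∀ {π} → JointPlay π → ∃[ z ] JointPlay (π ∷ʳ z)) →
                    ∃[ g ] IsProduct f f′ (inf g)
  infiniteProduct step = g , record
    { isPlay    = play ∘ joint
    ; coherent  = follows⇒coherent f (inf g) (follows-inf f g (follows ∘ joint))
    ; coherent′ = follows⇒coherent f′ (inf g) (follows-inf f′ g (follows′ ∘ joint))
    -- No infinite play lies below a finite one, and between infinite plays `⊑` is pointwise `≈`,
    -- hence symmetric.
    ; maximal   = λ { (fin _) _ _ _ () ; (inf h) _ _ _ g⊑h → ≈-sym ∘ g⊑h }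
    }
    where
    state : ℕ → Σ[ π ∈ List (Hypergame ℓ) ] JointPlay π
    state zero    = [] , joint-[]
    state (suc n) = _ , proj₂ (step (proj₂ (state n)))
    g : ℕ → Hypergame ℓ
    g n = proj₁ (step (proj₂ (state n)))
    -- The states grow at the end of the list, whereas `applyUpTo` builds from the front.
    state≡ : ∀ n → proj₁ (state n) ≡ applyUpTo g n
    state≡ zero    = refl
    state≡ (suc n) = trans (cong (_∷ʳ g n) (state≡ n)) (applyUpTo-∷ʳ g n)
    joint : ∀ n → JointPlay (applyUpTo g n)
    joint n = subst JointPlay (state≡ n) (proj₂ (state n))

  module _ (em : ∀ {p} → ExcludedMiddle p) where

    -- A proper legal continuation of `π` would exhibit a legal next move, and `joint-∷ʳ` would then
    -- extend the joint play.
    finiteProduct : JointPlay π → ¬ (∃[ z ] JointPlay (π ∷ʳ z)) → IsProduct f f′ (fin π)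
    finiteProduct {π} j stuck = record
      { isPlay    = play j
      ; coherent  = follows⇒coherent f (fin π) (follows j)
      ; coherent′ = follows⇒coherent f′ (fin π) (follows′ j)
      ; maximal   = λ ρ q _ _ π⊑ρ → decidable-stable em λ ρ⋢π →
          let w , w⊑ρ = ⊏⇒∷ʳ⊑ π ρ (π⊑ρ , ρ⋢π)
          in stuck (joint-∷ʳ j (play-finite (π ∷ʳ w) ρ q w⊑ρ))
      }

    product : ∃[ p ] IsProduct f f′ p
    -- Either some joint play has no joint extension and is the product, or extending can be
    -- iterated forever from the empty play.
    product with em {P = ∃[ π ] JointPlay π × ¬ (∃[ z ] JointPlay (π ∷ʳ z))}
    ... | yes (π , j , stuck) = fin π , finiteProduct j stuck
    ... | no ¬stuck with infiniteProduct (λ j → decidable-stable em λ ¬z → ¬stuck (_ , j , ¬z))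
    ...   | g , prod = inf g , prod

    -- Induction on the last move. If `p` stopped at `π`, then `π ∷ʳ z` would contradict its
    -- maximality; otherwise `p` goes on with some `w`, which is `z` up to `≈` by uniqueness.
    joint⊑product : ∀ p → IsProduct f f′ p → ∀ {π} → Reverse π → JointPlay π → fin π ⊑ p
    joint⊑product (fin _) prod [] j = []
    joint⊑product (inf _) prod [] j = []
    joint⊑product p prod (π ∶ v ∶ʳ z) j = decidable-stable em λ z⋢p →
      let w , w⊑p = ⊏⇒∷ʳ⊑ π p (π⊑p , λ p⊑π → z⋢p
            (maximal prod (fin (π ∷ʳ z)) (play j)
              (follows⇒coherent f (fin (π ∷ʳ z)) (follows j))
              (follows⇒coherent f′ (fin (π ∷ʳ z)) (follows′ j))
              (⊑-∷ʳ p p⊑π)))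
          z≈w = follows-both-unique p (coherent⇒follows f p (coherent prod))
                  (coherent⇒follows f′ p (coherent′ prod)) π (play j) (follows j) (follows′ j) w⊑p
      in z⋢p (⊑-transˡ p (Prefix.fromPointwise (∷ʳ-cong (Pointwise.refl ≈-refl) z≈w)) w⊑p)
      where
      ⊑-∷ʳ : ∀ p → p ⊑ fin π → p ⊑ fin (π ∷ʳ z)
      ⊑-∷ʳ (fin _) q = prefix-trans q (prefix-∷ʳ π)
      π⊑p : fin π ⊑ p
      π⊑p = joint⊑product p prod v record
        { play     = finitePlay-prefix ≈-refl (prefix-∷ʳ π) (play j)
        ; follows  = follows-prefix f (prefix-∷ʳ π) (follows j)
        ; follows′ = follows-prefix f′ (prefix-∷ʳ π) (follows′ j)
        }

-- Invariants and the greatest fixpoint.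

-- S t z concerns the position z with side t to move.
record Invariant (K : Side) (S : Side → Hypergame ℓ → Set r) : Set (lsuc ℓ ⊔ r) where
  field
    move  : S K z → ∃[ z′ ] z′ ∈[ K ] z × S (opp K) z′
    reply : S (opp K) z → w ∈[ opp K ] z → S K w

open Invariant

-- Strategies fix positions only up to `≈`, while an invariant may tell bisimilar graphs apart.
closure : (Side → Hypergame ℓ → Set r) → Side → Hypergame ℓ → Set (lsuc ℓ ⊔ r)
closure S t z = ∃[ y ] y ≈ z × S t y

closure-invariant : ∀ {S : Side → Hypergame ℓ → Set r} → Invariant K S → Invariant K (closure S)
move  (closure-invariant inv) (y , y≈z , i) with move inv i
... | w , o , i′ = w , ∈-respʳ y≈z o , w , ≈-refl , i′
reply (closure-invariant inv) (y , y≈z , i) o = _ , ≈-refl , reply inv i (∈-respʳ (≈-sym y≈z) o)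

-- Against `𝟘`, unfolding `▶` asks for some option, so it serves the turn of `K`; unfolding `⊵` asks
-- for all options, so it serves the opponent's turn. The place of `𝟘` decides which side's options
-- of `z` are meant.
Safe : Side → Side → Hypergame ℓ → Set (lsuc (lsuc ℓ))
Safe L L z = 𝟘 ▶ z
Safe L R z = z ⊵ 𝟘
Safe R L z = 𝟘 ⊵ z
Safe R R z = z ▶ 𝟘

safe-invariant : ∀ K → Invariant {ℓ} K (Safe K)
move (safe-invariant L) i with proj₂ ⊵▶-postfixed i
-- This disjunct would need an option of `𝟘`.
... | inj₁ (_ , (_ , () , _) , _)
... | inj₂ m = m
reply (safe-invariant L) i = proj₁ (proj₁ ⊵▶-postfixed i)
move (safe-invariant R) i with proj₂ ⊵▶-postfixed i
... | inj₁ m = m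
... | inj₂ (_ , (_ , () , _) , _)
reply (safe-invariant R) i = proj₂ (proj₁ ⊵▶-postfixed i)

-- Coinduction: `S`, with the other argument pinned to `𝟘`, is a pair `P` with `P ⊆₂ Φ P`. The level
-- of `S` is the one over which `⊵` and `▶` take their union.
invariant⇒safe : ∀ {S : Side → Hypergame ℓ → Set (lsuc ℓ)} K → Invariant K S →
                 ∀ t → S t z → Safe K t z
invariant⇒safe {ℓ} {S = S} L inv = λ { L i → P , post , refl , i ; R i → P , post , refl , i }
  where
  P : RelPair ℓ (lsuc ℓ)
  -- Pinning by `≡` lets `refl` expose that `𝟘` has no options, which settles the remaining
  -- conjunct.
  P = (λ x y → y ≡ 𝟘 × S R x) , (λ x y → x ≡ 𝟘 × S L y)
  post : P ⊆₂ Φ P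
  post = (λ { (refl , i) → (λ o → refl , reply inv i o) , λ { (_ , () , _) } })
       , (λ { (refl , i) → let z , o , i′ = move inv i in inj₂ (z , o , refl , i′) })
invariant⇒safe {ℓ} {S = S} R inv = λ { L i → P , post , refl , i ; R i → P , post , refl , i }
  where
  P : RelPair ℓ (lsuc ℓ)
  P = (λ x y → x ≡ 𝟘 × S L y) , (λ x y → y ≡ 𝟘 × S R x)
  post : P ⊆₂ Φ P
  post = (λ { (refl , i) → (λ { (_ , () , _) }) , λ o → refl , reply inv i o })
       , (λ { (refl , i) → let z , o , i′ = move inv i in inj₁ (z , o , refl , i′) })

-- Strategies that prefer a given kind of move.

module _ (em : ∀ {p} → ExcludedMiddle p) (ac : AxiomOfChoice) where

  -- The strategy which makes a legal move related to the current play by Q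
  -- whenever there is one.  Choosing for the representative of the play makes
  -- the choice depend on the play up to ≈ only.
  module Preferring (A : Agent) (x : Hypergame ℓ) (Q : List (Hypergame ℓ) → Hypergame ℓ → Set r)
                    (Q-resp : ∀ {π ρ z} → Pointwise _≈_ π ρ → Q π z → Q ρ z) where

    open Representatives (ac (movesSetoid ℓ))

    Legal : List (Hypergame ℓ) → Hypergame ℓ → Set (lsuc ℓ)
    Legal π z = IsFinitePlay (starter A) x (π ∷ʳ z)

    legal-resp : Pointwise _≈_ π ρ → Legal π z → Legal ρ z
    legal-resp e =
      finitePlay-cong (∷ʳ-cong (Pointwise.symmetric ≈-sym e) ≈-refl)

    pick : List (Hypergame ℓ) → Maybe (Hypergame ℓ)
    pick π with em {P = ∃[ z ] Legal π z × Q π z} | em {P = ∃[ z ] Legal π z}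
    ... | yes (z , _) | _           = just z
    -- Falling back on any legal move keeps the strategy total where `Q` cannot be met.
    ... | no _        | yes (z , _) = just z
    ... | no _        | no _        = nothing

    pick-legal : ∀ π → pick π ≡ just z → Legal π z
    pick-legal π c with em {P = ∃[ z ] Legal π z × Q π z} | em {P = ∃[ z ] Legal π z}
    pick-legal π refl | yes (_ , l , _) | _           = l
    pick-legal π refl | no _            | yes (_ , l) = l

    pick-total : ∀ π → Legal π z → ∃[ w ] pick π ≡ just w
    pick-total π l with em {P = ∃[ z ] Legal π z × Q π z} | em {P = ∃[ z ] Legal π z}
    ... | yes _ | _     = _ , refl
    ... | no _  | yes _ = _ , refl
    ... | no _  | no ¬l = contradiction (_ , l) ¬l

    pick-preferred : ∀ π → Legal π z → Q π z → pick π ≡ just w → Q π w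
    pick-preferred π l q c with em {P = ∃[ z ] Legal π z × Q π z} | em {P = ∃[ z ] Legal π z}
    pick-preferred π l q refl | yes (_ , _ , q′) | _ = q′
    pick-preferred π l q c    | no ¬q            | _ = contradiction (_ , l , q) ¬q

    strategy : Strategy A x
    choose      strategy p = pick (rep (moves p))
    choose-cong strategy {p} {q} e rewrite rep-cong e = Maybe.refl ≈-refl
    legal       strategy p c = legal-resp (rep-≈ (moves p)) (pick-legal _ c)
    total       strategy p l = pick-total _ (legal-resp (Pointwise.symmetric ≈-sym (rep-≈ (moves p))) l)

    -- The choice is made at the representative, so legality and `Q` are carried there and the
    -- result is carried back.
    strategy-preferred : ∀ p → Legal (moves p) z → Q (moves p) z →
                         choose strategy p ≡ just w → Q (moves p) w
    strategy-preferred p l q c = Q-resp e (pick-preferred _ (legal-resp e⁻¹ l) (Q-resp e⁻¹ q) c)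
      where
      e   = rep-≈ (moves p)
      e⁻¹ = Pointwise.symmetric ≈-sym e

  -- From invariants to non-losing strategies.

  module Staying {K s : Side} {x : Hypergame ℓ} {S : Side → Hypergame ℓ → Set r}
                 (inv : Invariant K S) (start : S s x) where

    inv′ : Invariant K (closure S)
    inv′ = closure-invariant inv

    open Preferring (agent K s) x (λ _ → closure S (opp K)) (λ _ i → i) public

    -- Induction on the last move: a move of the opponent is covered by `reply`, and a move of `K`
    -- was chosen to stay.
    stays : Reverse π → IsFinitePlay s x π → Follows strategy (fin π) → closure S (next s π) (final x π)
    stays [] _ _ = x , ≈-refl , start
    stays (π ∶ v ∶ʳ z) q fol
      with stays v (finitePlay-prefix ≈-refl (prefix-∷ʳ π) q) (follows-prefix strategy (prefix-∷ʳ π) fol)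
    ... | i rewrite next-∷ʳ s π {z} | final-∷ʳ x π {z} with ≡⊎≡opp (next s π) K
    ...   | inj₂ t rewrite t | opp-involutive K =
      reply inv′ i (subst (λ t → z ∈[ t ] final x π) t (finitePlay-last π q))
    ...   | inj₁ t = subst (λ t → closure S (opp t) z) (sym t) chosen
      where
      p : FPlay (agent K s) x
      p = record { moves = π ; isPlay = finitePlay-prefix ≈-refl (prefix-∷ʳ π) q ; turn = t }
      chosen : closure S (opp K) z
      chosen with move inv′ (subst (λ t → closure S t (final x π)) t i)
      -- The move `v` only shows that staying is possible here; the strategy picks a possibly
      -- different `w` that stays, and the move `z` played is `w` up to `≈`.
      ... | v , o , j with total strategy p q
      ...   | w , c with strategy-preferred p
                           (finitePlay-∷ʳ (isPlay p) (subst (λ t → v ∈[ t ] final x π) (sym t) o)) j c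
      ...     | y , y≈w , k = y , ≈-trans y≈w (fol p prefix-refl c) , k

    nonLosing : NonLosing strategy
    nonLosing f′ with Joint.product strategy f′ em
    ... | inf g , prod = inf g , prod , inj₂ tt
    ... | fin π , prod = fin π , prod , inj₁ winning
      where
      open Joint strategy f′

      joint : JointPlay π
      joint = record
        { play     = isPlay prod
        ; follows  = coherent⇒follows strategy (fin π) (coherent prod)
        ; follows′ = coherent⇒follows f′ (fin π) (coherent′ prod)
        }

      -- An option for the side to move would give a longer joint play, against maximality of the
      -- product.
      stuck : ∀ {z} → ¬ (z ∈[ next s π ] final x π)
      stuck o with joint-∷ʳ joint (finitePlay-∷ʳ (isPlay prod) o)
      ... | w , j = ∷ʳ⋢ π (fin (π ∷ʳ w)) prefix-refl
        (maximal prod (fin (π ∷ʳ w)) (JointPlay.play j)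
          (follows⇒coherent strategy (fin (π ∷ʳ w)) (JointPlay.follows j))
          (follows⇒coherent f′ (fin (π ∷ʳ w)) (JointPlay.follows′ j))
          (prefix-∷ʳ π))

      winning : Winning s x K (fin π)
      winning with ≡⊎≡opp (next s π) K
      ... | inj₂ t = t , λ y o → stuck (subst (λ t → y ∈[ t ] final x π) (sym t) o)
      ... | inj₁ t with move inv′ (subst (λ t → closure S t (final x π)) t
                          (stays (reverseView π) (isPlay prod) (JointPlay.follows joint)))
      ...   | z , o , _ = ⊥-elim (stuck (subst (λ t → z ∈[ t ] final x π) (sym t) o))

  -- From non-losing strategies to invariants.

  module Reaching {K s : Side} {x : Hypergame ℓ} (f : Strategy (agent K s) x) (nl : NonLosing f) where

    Reached : Side → Hypergame ℓ → Set (lsuc ℓ)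
    Reached t z = ∃[ π ] IsFinitePlay s x π × Follows f (fin π) × next s π ≡ t × final x π ≈ z

    -- Against an opponent who prefers to move along `π`, the product contains `π` and cannot go
    -- beyond it, so it ends with `K` to move and is no win for `K`.
    notStuck : IsFinitePlay s x π → Follows f (fin π) → next s π ≡ K →
               ¬ (∀ z → ¬ (z ∈[ K ] final x π))
    notStuck {π} q fol t stuck = losing (proj₁ play′) π⊑p p⊑π (proj₂ (proj₂ play′))
      where
      open Preferring (agent (opp K) s) x (λ σ z → fin (σ ∷ʳ z) ⊑ fin π)
        (λ e → prefix-trans (Prefix.fromPointwise (∷ʳ-cong (Pointwise.symmetric ≈-sym e) ≈-refl)))
      open Joint f strategy

      play′ = nl strategy
      prod = proj₁ (proj₂ play′)

      joint : JointPlay π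
      joint = record
        { play     = q
        ; follows  = fol
        -- The entry of `π` after `σ` is itself a legal preferred move, so the strategy's choice
        -- also continues along `π`.
        ; follows′ = λ σ w⊑π c → ∷ʳ⊑-unique (moves σ) (fin π)
            (strategy-preferred σ (finitePlay-prefix ≈-refl w⊑π q) w⊑π c) w⊑π
        }

      π⊑p : fin π ⊑ proj₁ play′
      π⊑p = joint⊑product em (proj₁ play′) prod (reverseView π) joint

      p⊑π : proj₁ play′ ⊑ fin π
      p⊑π = decidable-stable em λ p⋢π →
        let w , w⊑p = ⊏⇒∷ʳ⊑ π (proj₁ play′) (π⊑p , p⋢π)
        in stuck w (subst (λ t → w ∈[ t ] final x π) t
             (finitePlay-last π (play-finite (π ∷ʳ w) (proj₁ play′) (isPlay prod) w⊑p)))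

      losing : ∀ p → fin π ⊑ p → p ⊑ fin π → ¬ NonLosingPlay s x K p
      losing (fin σ) π⊑σ σ⊑π (inj₁ (t′ , _)) =
        opp-≢ (trans (sym t) (trans (next-cong (Prefix.antisym (λ e _ → e) π⊑σ σ⊑π)) t′))

    reached-invariant : Invariant K Reached
    move reached-invariant (π , q , fol , t , e)
      with em {P = ∃[ z ] z ∈[ K ] final x π}
    ... | no ¬z = ⊥-elim (notStuck q fol t (λ z o → ¬z (z , o)))
    -- The option `y` only triggers totality; the move that stays among the reached positions is the
    -- one chosen by `f`.
    ... | yes (y , o) with total f (record { moves = π ; isPlay = q ; turn = t })
                        (finitePlay-∷ʳ q (subst (λ t → y ∈[ t ] final x π) (sym t) o))
    ...   | z , c =
      z , ∈-respʳ e (subst (λ t → z ∈[ t ] final x π) t (finitePlay-last π (legal f _ c)))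
        , π ∷ʳ z , legal f _ c , follows-∷ʳ-chosen f _ fol c
        , trans (next-∷ʳ s π) (cong opp t) , subst (_≈ z) (sym (final-∷ʳ x π)) ≈-refl
    reply reached-invariant {w = w} (π , q , fol , t , e) o =
      π ∷ʳ w , finitePlay-∷ʳ q (∈-respʳ (≈-sym e) (subst (λ t → w ∈[ t ] _) (sym t) o))
        , follows-∷ʳ-idle f fol (λ t′ → opp-≢ (trans (sym t′) t))
        , trans (next-∷ʳ s π) (trans (cong opp t) (opp-involutive K))
        , subst (_≈ w) (sym (final-∷ʳ x π)) ≈-refl

    safe : Safe K s x
    safe = invariant⇒safe K reached-invariant s ([] , [] , follows-[] f , refl , ≈-refl)

  -- All four agents at once: the starter `s` is also the side to move at `x`.
  safe⇔nonLosing : ∀ K s (x : Hypergame ℓ) →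
                   Safe K s x ⇔ (Σ[ f ∈ Strategy (agent K s) x ] NonLosing f)
  safe⇔nonLosing K s x = mk⇔
    (λ i → Staying.strategy (safe-invariant K) i , Staying.nonLosing (safe-invariant K) i)
    (λ (f , nl) → Reaching.safe f nl)

-- Assembly of the four equivalences.

Σ-×-⇔ : ∀ {a b c d e g} {A : Set a} {B : Set b} {C : Set c} {D : Set d} {P : C → Set e} {Q : D → Set g} →
        A ⇔ (Σ[ c ∈ C ] P c) → B ⇔ (Σ[ d ∈ D ] Q d) →
        (A × B) ⇔ (Σ[ cd ∈ C × D ] P (proj₁ cd) × Q (proj₂ cd))
Σ-×-⇔ F G = mk⇔
  (λ (a , b) → let c , p = Equivalence.to F a ; d , q = Equivalence.to G b in (c , d) , p , q)
  (λ ((c , d) , p , q) → Equivalence.from F (c , p) , Equivalence.from G (d , q))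

×-swap-⇔ : ∀ {a b c} {A : Set a} {B : Set b} {C : Set c} → (A × B) ⇔ C → (B × A) ⇔ C
×-swap-⇔ F = mk⇔ (Equivalence.to F ∘ swap) (swap ∘ Equivalence.from F)

theorem2p22 : (∀ {p} → ExcludedMiddle p) → AxiomOfChoice →
    ∀ {ℓ} (x : Hypergame ℓ) →
    (x ▷ 𝟘 ⇔ HasNonLosingStrategyFor Left x) ×
    (x ◁ 𝟘 ⇔ HasNonLosingStrategyFor Right x) ×
    (x ⋈ 𝟘 ⇔ HasNonLosingStrategyFor II x) ×
    (x ∥ 𝟘 ⇔ HasNonLosingStrategyFor I x)
theorem2p22 em ac x =
    -- The swaps reconcile the order of the conjuncts of each relation with that of `components`;
    -- for `⋈` the two orders agree.
    ×-swap-⇔ (Σ-×-⇔ (safe⇔ L L x) (safe⇔ L R x))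
  , ×-swap-⇔ (Σ-×-⇔ (safe⇔ R R x) (safe⇔ R L x))
  , Σ-×-⇔ (safe⇔ L R x) (safe⇔ R L x)
  , ×-swap-⇔ (Σ-×-⇔ (safe⇔ L L x) (safe⇔ R R x))
  where
  safe⇔ = safe⇔nonLosing em ac
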